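{- Let $\ell \geq 4$ be an even integer. If $m \ge 2$ is even and $n$ is an even integer with $n > \frac{\ell^2+2\ell-4}{2}$, then the honeycomb toroidal graph $\mathrm{HTG}(m,n,\ell)$ is 2-spanning cyclable.
   Context: For integers $m\ge 1$, $\ell\ge 0$ and $n\ge 4$ with $n$ even and $m-\ell$ even, the honeycomb toroidal graph $\mathrm{HTG}(m,n,\ell)$ is the simple graph with vertex set $\{u_{i,j}: 0\le i\le m-1,\ 0\le j\le n-1\}$ (first subscript computed modulo $m$, second modulo $n$) whose edge set is the set of the following unordered pairs: $\{u_{i,j},u_{i,j+1}\}$ for all $i,j$ (vertical edges); $\{u_{i,j},u_{i+1,j}\}$ for all $0\le i\le m-2$ with $i+j$ odd (flat edges); and $\{u_{m-1,j},u_{0,j+\ell}\}$ for all $j$ having the same parity as $m$ (and $\ell$) (jump edges). A 2-factor of a graph is a spanning subgraph in which every vertex has valency 2. A graph $X$ is 2-spanning cyclable if for every pair of distinct vertices $u,v$ of $X$ there is a 2-factor of $X$ consisting of exactly two cycles such that $u$ and $v$ lie in different cycles. -}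

module Defs where

open import Data.Nat using (ℕ; zero; suc; _+_; _*_; _∸_; _≤_; _<_)
open import Data.Nat.Divisibility using (_∣_)
open import Data.Fin using (Fin; toℕ)
open import Data.Product using (Σ; ∃; ∃-syntax; _×_; _,_)
open import Data.Sum using (_⊎_)
open import Relation.Binary.PropositionalEquality using (_≡_; _≢_)
open import Relation.Nullary using (¬_)
open import Function.Definitions using (Injective)

Even : ℕ → Set
Even a = 2 ∣ a

Odd : ℕ → Set
Odd a = ¬ Even a

_≡_[mod_] : ℕ → ℕ → ℕ → Set
a ≡ b [mod n ] = (∃[ k ] a ≡ b + k * n) ⊎ (∃[ k ] b ≡ a + k * n)

HTGVertex : ℕ → ℕ → Set
HTGVertex m n = Fin m × Fin n

data HTGArc (m n ℓ : ℕ) : HTGVertex m n → HTGVertex m n → Set where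
  vertical : ∀ {i j j'} → toℕ j' ≡ suc (toℕ j) [mod n ] →
             HTGArc m n ℓ (i , j) (i , j')
  flat : ∀ {i i' j} → toℕ i' ≡ suc (toℕ i) → Odd (toℕ i + toℕ j) →
         HTGArc m n ℓ (i , j) (i' , j)
  jump : ∀ {i i' j j'} → suc (toℕ i) ≡ m → toℕ i' ≡ 0 →
         toℕ j' ≡ toℕ j + ℓ [mod n ] → toℕ j ≡ m [mod 2 ] →
         HTGArc m n ℓ (i , j) (i' , j')

HTGAdj : (m n ℓ : ℕ) → HTGVertex m n → HTGVertex m n → Set
HTGAdj m n ℓ x y = HTGArc m n ℓ x y ⊎ HTGArc m n ℓ y x

record Cycle (V : Set) (Adj : V → V → Set) : Set where
  field
    len      : ℕ
    len≥3    : 3 ≤ len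
    vert     : Fin len → V
    distinct : Injective _≡_ _≡_ vert
    adjacent : ∀ (a b : Fin len) →
               (suc (toℕ a) ≡ toℕ b ⊎ (suc (toℕ a) ≡ len × toℕ b ≡ 0)) →
               Adj (vert a) (vert b)

_∈Cycle_ : {V : Set} {Adj : V → V → Set} → V → Cycle V Adj → Set
w ∈Cycle C = ∃[ a ] Cycle.vert C a ≡ w

-- a 2-factor consisting of exactly two cycles: two vertex-disjoint cycles
-- covering every vertex (the 2-factor's edges are exactly the cycle edges)
record TwoCycle2Factor (V : Set) (Adj : V → V → Set) : Set where
  field
    C₁ C₂    : Cycle V Adj
    disjoint : ∀ w → w ∈Cycle C₁ → ¬ (w ∈Cycle C₂)
    spanning : ∀ w → w ∈Cycle C₁ ⊎ w ∈Cycle C₂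

TwoSpanningCyclable : (V : Set) → (V → V → Set) → Set
TwoSpanningCyclable V Adj =
  ∀ (u v : V) → u ≢ v →
  Σ (TwoCycle2Factor V Adj) λ F →
    (u ∈Cycle TwoCycle2Factor.C₁ F) × (v ∈Cycle TwoCycle2Factor.C₂ F)

HTG-2SpanningCyclable : ℕ → ℕ → ℕ → Set
HTG-2SpanningCyclable m n ℓ = TwoSpanningCyclable (HTGVertex m n) (HTGAdj m n ℓ)

{-# OPTIONS --safe #-}
-- A single 2-factor and its translates suffice. One of its cycles is the ring, the boundary of ℓ/2 − 1
-- hexagons stacked between two neighbouring columns; it spans ℓ − 1 rows of both columns. The rest is
-- traversed upwards along the last column, block by block: a block of height ℓ or ℓ + 2 is a
-- boustrophedon through all columns that uses one jump edge, and a block of height 2ℓ detours around the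
-- ring. The bound on n is the Frobenius bound that makes n a sum 2ℓ + A ℓ + B (ℓ + 2). Since the ring is
-- short, for u ≠ v one of its translates has u on a corner or next to a corner, and misses v.
module Submission where

open import Defs
open import Data.Nat using (ℕ; zero; suc; _+_; _*_; _≤_; _<_; z≤n; s≤s; NonZero; _/_; _%_; pred)
open import Data.Nat.Properties
open import Data.Nat.Divisibility
open import Data.Nat.DivMod
open import Data.Nat.Tactic.RingSolver using (solve-∀)
open import Data.Fin using (Fin; zero; suc; toℕ)
open import Data.Fin.Properties using (toℕ-injective; toℕ-fromℕ<; toℕ<n)
open import Data.Product using (Σ; ∃₂; ∃-syntax; _×_; _,_; proj₁; proj₂)
open import Data.Product.Properties using (,-injective)
open import Data.Sum using (_⊎_; inj₁; inj₂; swap; [_,_]′)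
import Data.Sum as Sum
open import Data.List using (List; []; _∷_; _++_; [_]; _∷ʳ_; length; lookup)
open import Data.List.Properties using (++-assoc; ++-identityʳ; length-++; length-++-≤ˡ; length-++-≤ʳ)
open import Data.List.Membership.Propositional using (_∈_)
open import Data.List.Membership.Propositional.Properties using (∈-++⁺ˡ; ∈-++⁺ʳ; ∈-++⁻; ∈-lookup)
open import Data.List.Relation.Unary.All as All using ([]; _∷_)
import Data.List.Relation.Unary.All.Properties as All
open import Data.List.Relation.Unary.Any using (here; there; index)
open import Data.List.Relation.Unary.Any.Properties using (lookup-index)
open import Data.List.Relation.Unary.AllPairs using ([]; _∷_)
open import Data.List.Relation.Unary.Unique.Propositional using (Unique)
import Data.List.Relation.Unary.Unique.Propositional.Properties as Unique
open import Data.List.Relation.Binary.Disjoint.Propositional using (Disjoint)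
open import Data.List.Relation.Binary.Permutation.Propositional
  using (_↭_; prep; ↭-sym; ↭-trans; ↭-refl; ↭-reflexive; ↭⇒↭ₛ)
open import Data.List.Relation.Binary.Permutation.Propositional.Properties
  using (∷↭∷ʳ; ++⁺; ++⁺ˡ; ++⁺ʳ; ∈-resp-↭; ++-commutativeMonoid)
open import Data.List.Relation.Binary.Permutation.Setoid.Properties using (Unique-resp-↭)
open import Relation.Binary.PropositionalEquality hiding ([_])
open import Relation.Nullary using (¬_; contradiction)
open import Function using (_∘_; _on_)

-- Lists of grid points, walks, and rectangles as unions of columns

Point : Set
Point = ℕ × ℕ

open import Algebra.Solver.CommutativeMonoid (++-commutativeMonoid {A = Point})
  using (solve; _⊕_; _⊜_)

even-+ : ∀ {x y} → Even x → Even y → Even (x + y)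
even-+ = ∣m∣n⇒∣m+n

odd-suc : ∀ {x} → Even x → Odd (suc x)
odd-suc e o with ∣m+n∣m⇒∣n {2} {_} {1} (subst Even (+-comm 1 _) o) e
... | d with ∣⇒≤ d
... | s≤s ()

-- The start P is not listed in a walk, whereas its end is.
data Walk {V : Set} (_~_ : V → V → Set) : V → List V → V → Set where
  []  : ∀ {P} → Walk _~_ P [] P
  _∷_ : ∀ {P Q R l} → P ~ Q → Walk _~_ Q l R → Walk _~_ P (Q ∷ l) R

infixr 5 _◅◅_

_◅◅_ : ∀ {V : Set} {_~_ : V → V → Set} {P Q R l l′} →
       Walk _~_ P l Q → Walk _~_ Q l′ R → Walk _~_ P (l ++ l′) R
[]      ◅◅ w′ = w′
(e ∷ w) ◅◅ w′ = e ∷ (w ◅◅ w′)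

-- The k points of column x in the rows p + 1, …, p + k.
up down : ℕ → ℕ → ℕ → List Point
up x p zero    = []
up x p (suc k) = up x p k ∷ʳ (x , suc k + p)
down x p zero    = []
down x p (suc k) = (x , suc k + p) ∷ down x p k

-- zig enters at the top of column 0 and leaves at the top of the last of its 2M columns;
-- zag runs backwards through the columns.
zig zag rect : ℕ → ℕ → ℕ → List Point
zig zero    p h = []
zig (suc M) p h = zig M p h ++ down (M * 2) p h ++ up (suc (M * 2)) p h
zag zero    p h = []
zag (suc M) p h = down (suc (M * 2)) p h ++ up (M * 2) p h ++ zag M p h
rect zero    p h = []
rect (suc w) p h = rect w p h ++ up w p h

down↭up : ∀ x p k → down x p k ↭ up x p k
down↭up x p zero    = ↭-refl
down↭up x p (suc k) = ↭-trans (prep _ (down↭up x p k)) (∷↭∷ʳ _ _)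

up-+ : ∀ x p j k → up x p (j + k) ≡ up x p j ++ up x (j + p) k
up-+ x p j zero = trans (cong (up x p) (+-identityʳ j)) (sym (++-identityʳ _))
up-+ x p j (suc k) = begin
  up x p (j + suc k)                                   ≡⟨ cong (up x p) (+-suc j k) ⟩
  up x p (j + k) ∷ʳ (x , suc (j + k) + p)              ≡⟨ cong₂ _∷ʳ_ (up-+ x p j k) (cong (x ,_) (eq j k p)) ⟩
  (up x p j ++ up x (j + p) k) ∷ʳ (x , suc k + (j + p)) ≡⟨ ++-assoc (up x p j) _ _ ⟩
  up x p j ++ up x (j + p) (suc k)                     ∎
  where
  open ≡-Reasoning
  eq : ∀ j k p → suc (j + k) + p ≡ suc k + (j + p)
  eq = solve-∀

-- `rect` runs column by column, so stacking two rectangles interleaves their columns; equality can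
-- hold only up to permutation.
rect-+ : ∀ w p j k → rect w p (j + k) ↭ rect w p j ++ rect w (j + p) k
rect-+ zero    p j k = ↭-refl
rect-+ (suc w) p j k = ↭-trans (++⁺ (rect-+ w p j k) (↭-reflexive (up-+ w p j k)))
  (solve 4 (λ a b c d → (a ⊕ b) ⊕ (c ⊕ d) ⊜ (a ⊕ c) ⊕ (b ⊕ d)) ↭-refl
     (rect w p j) (rect w (j + p) k) (up w p j) (up w (j + p) k))

zig↭rect : ∀ M p h → zig M p h ↭ rect (M * 2) p h
zig↭rect zero    p h = ↭-refl
zig↭rect (suc M) p h = ↭-trans (++⁺ (zig↭rect M p h) (++⁺ʳ _ (down↭up (M * 2) p h)))
  (↭-reflexive (sym (++-assoc (rect (M * 2) p h) _ _)))

zag↭rect : ∀ M p h → zag M p h ↭ rect (M * 2) p h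
zag↭rect zero    p h = ↭-refl
zag↭rect (suc M) p h = ↭-trans (++⁺ (down↭up (suc (M * 2)) p h) (++⁺ˡ _ (zag↭rect M p h)))
  (solve 3 (λ a b c → a ⊕ b ⊕ c ⊜ (c ⊕ b) ⊕ a) ↭-refl
     (up (suc (M * 2)) p h) (up (M * 2) p h) (rect (M * 2) p h))

-- Walks in the strip: blocks, the ring and the detour around it

module Strip (M k : ℕ) (evenℓ : Even (suc k)) where

  ℓ a b m : ℕ
  ℓ = suc k
  a = M * 2
  b = suc a
  m = suc b

  -- Rows are not reduced modulo `n` here, so heights are compared by plain addition. As `b` is odd,
  -- a jump obeys the parity rule of a flat edge leaving column `b`.
  data Arc : Point → Point → Set where
    vertical : ∀ {x y} → Arc (x , y) (x , suc y)
    flat     : ∀ {x y} → Odd (x + y) → Arc (x , y) (suc x , y)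
    jump     : ∀ {y} → Even y → Arc (b , y) (0 , ℓ + y)

  Adj : Point → Point → Set
  Adj P Q = Arc P Q ⊎ Arc Q P

  endsAt : ∀ {P l x y y′} → y ≡ y′ → Walk Adj P l (x , y) → Walk Adj P l (x , y′)
  endsAt refl w = w

  even-cols : ∀ N → Even (N * 2)
  even-cols N = n∣m*n N

  upWalk : ∀ {P x p} j → Adj P (x , suc p) → Walk Adj P (up x p (suc j)) (x , suc j + p)
  upWalk zero    e = e ∷ []
  upWalk (suc j) e = upWalk j e ◅◅ inj₁ vertical ∷ []

  downWalk : ∀ {P x p} j → Adj P (x , suc j + p) → Walk Adj P (down x p (suc j)) (x , suc p)
  downWalk zero    e = e ∷ []
  downWalk (suc j) e = e ∷ downWalk j (inj₂ vertical)

  flat-bottom : ∀ {x p} → Even x → Even p → Arc (x , suc p) (suc x , suc p)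
  flat-bottom {x} {p} ex ep = flat (subst Odd (sym (+-suc x p)) (odd-suc (even-+ ex ep)))

  flat-top : ∀ {x p} → Even x → Even p → Arc (suc x , p) (suc (suc x) , p)
  flat-top ex ep = flat (odd-suc (even-+ ex ep))

  zig-step : ∀ {P p j} N → Even p → Adj P (N * 2 , suc j + p) →
             Walk Adj P (down (N * 2) p (suc j) ++ up (suc (N * 2)) p (suc j)) (suc (N * 2) , suc j + p)
  zig-step {j = j} N ep e = downWalk j e ◅◅ upWalk j (inj₁ (flat-bottom (even-cols N) ep))

  -- The walk stops one edge short of column `N * 2`, so that the caller may enter that column
  -- downwards (`straightBlock`) or upwards (`detourWalk`). For `N = 0` the pending edge is the
  -- given `e`.
  zigWalk : ∀ {P p j} N → Even p → Even (suc j) → Adj P (0 , suc j + p) →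
            ∃[ R ] Walk Adj P (zig N p (suc j)) R × Adj R (N * 2 , suc j + p)
  zigWalk zero    ep ej e = _ , [] , e
  zigWalk (suc N) ep ej e with zigWalk N ep ej e
  ... | R , w , e′ = _ , w ◅◅ zig-step N ep e′ , inj₁ (flat-top (even-cols N) (even-+ ej ep))

  zagWalk : ∀ {p j} N → Even p → Even (suc j) →
            Walk Adj (N * 2 , suc j + p) (zag N p (suc j)) (0 , suc j + p)
  zagWalk zero    ep ej = []
  zagWalk {j = j} (suc N) ep ej =
    downWalk j (inj₂ (flat-top (even-cols N) (even-+ ej ep))) ◅◅
    upWalk j (inj₂ (flat-bottom (even-cols N) ep)) ◅◅ zagWalk N ep ej

  -- Appended to a walk that has reached row p of the last column, a block extends it to row h + p.
  record Block (p h : ℕ) : Set where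
    field
      points : List Point
      walk   : Walk Adj (b , p) points (b , h + p)
      fills  : points ↭ rect m p h
  open Block

  emptyBlock : ∀ p → Block p 0
  emptyBlock p = record { points = [] ; walk = [] ; fills = ↭-sym (rect-empty m) }
    where
    rect-empty : ∀ w → rect w p 0 ↭ []
    rect-empty zero    = ↭-refl
    rect-empty (suc w) = ↭-trans (↭-reflexive (++-identityʳ _)) (rect-empty w)

  stack : ∀ {p h h′} → Block p h → Block (h + p) h′ → Block p (h + h′)
  stack {p} {h} {h′} B C = record
    { points = points B ++ points C
    ; walk   = walk B ◅◅ endsAt (eq h h′ p) (walk C)
    ; fills  = ↭-trans (++⁺ (fills B) (fills C)) (↭-sym (rect-+ m p h h′)) }
    where
    eq : ∀ h h′ p → h′ + (h + p) ≡ h + h′ + p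
    eq = solve-∀

  iterate : ∀ {h} → Even h → (∀ {p} → Even p → Block p h) → ∀ N {p} → Even p → Block p (N * h)
  iterate eh B zero    ep = emptyBlock _
  iterate eh B (suc N) ep = stack (B ep) (iterate eh B N (even-+ eh ep))

  -- The height is dictated by the jump: it leads from row `p` to row `ℓ + p` of column 0, the top
  -- row at which `zig` enters.
  straightBlock : ∀ {p} → Even p → Block p ℓ
  straightBlock {p} ep with zigWalk M ep evenℓ (inj₁ (jump ep))
  ... | R , w , e = record
    { points = zig (suc M) p ℓ
    ; walk   = w ◅◅ zig-step M ep e
    ; fills  = zig↭rect (suc M) p ℓ }

  even-2+ℓ : Even (2 + ℓ)
  even-2+ℓ = even-+ ∣-refl evenℓ

  jump⁻ : ∀ {y y′} → Even y → ℓ + y ≡ y′ → Adj (0 , y′) (b , y)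
  jump⁻ ey refl = inj₂ (jump ey)

  climbingBlock : ∀ {p} → Even p → Block p (2 + ℓ)
  climbingBlock {p} ep = record
    -- After one step up, column `a` is climbed, the columns before it are traversed leftwards, and
    -- the jump is taken backwards from `(0 , 2 + ℓ + p)` to `(b , 2 + p)`, just above the point of
    -- column `b` already visited.
    { points = (b , suc p) ∷ up a p (2 + ℓ) ++ zag M p (2 + ℓ) ++ up b (suc p) (suc ℓ)
    ; walk   = inj₁ vertical ∷
               (upWalk (suc ℓ) (inj₂ (flat-bottom (even-cols M) ep)) ◅◅
                zagWalk M ep even-2+ℓ ◅◅
                endsAt (+-suc (suc ℓ) p)
                  (upWalk ℓ (jump⁻ (even-+ ∣-refl ep) (eq ℓ p))))
    ; fills  = ↭-trans
        (++⁺ (↭-refl {x = [ (b , suc p) ]}) (++⁺ (↭-refl {x = up a p (2 + ℓ)}) (++⁺ʳ _ (zag↭rect M p (2 + ℓ)))))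
        (↭-trans (solve 4 (λ c u r v → c ⊕ (u ⊕ (r ⊕ v)) ⊜ (r ⊕ u) ⊕ (c ⊕ v)) ↭-refl
                   [ (b , suc p) ] (up a p (2 + ℓ)) (rect a p (2 + ℓ)) (up b (suc p) (suc ℓ)))
                 (++⁺ˡ (rect b p (2 + ℓ)) (↭-reflexive (sym (up-+ b p 1 (suc ℓ)))))) }
    where
    eq : ∀ ℓ p → ℓ + (2 + p) ≡ 2 + ℓ + p
    eq = solve-∀

  ring : ℕ → List Point
  ring p = up a p k ++ down b p k

  -- One jump is taken forwards, from `(b , p)`; another backwards, from `(0 , ℓ + ℓ + p)` to
  -- `(b , ℓ + p)`. Columns `a` and `b` are used only from row `ℓ + p` on, just above the ring.
  detour : ℕ → List Point
  detour p = zig M p ℓ ++ up a (k + p) (suc ℓ) ++ zag M (ℓ + p) ℓ ++ up b (k + p) (suc ℓ)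

  detourWalk : ∀ {p} → Even p → Walk Adj (b , p) (detour p) (b , ℓ + ℓ + p)
  detourWalk {p} ep with zigWalk M ep evenℓ (inj₁ (jump ep))
  ... | R , w , e = w ◅◅
    endsAt (eq k p) (upWalk ℓ e) ◅◅
    zagWalk M (even-+ evenℓ ep) evenℓ ◅◅
    endsAt (trans (eq k p) (sym (+-assoc ℓ ℓ p)))
      (upWalk ℓ (jump⁻ (even-+ evenℓ ep) refl))
    where
    eq : ∀ k p → suc (suc k) + (k + p) ≡ suc k + (suc k + p)
    eq = solve-∀

  ring-detour : ∀ p → ring p ++ detour p ↭ rect m p (ℓ + ℓ)
  ring-detour p = ↭-trans
    (++⁺ (++⁺ˡ (up a p k) (down↭up b p k))
         (++⁺ (zig↭rect M p ℓ) (++⁺ˡ (up a (k + p) (suc ℓ)) (++⁺ʳ _ (zag↭rect M (ℓ + p) ℓ)))))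
    (↭-trans (solve 6 (λ u d z u′ y d′ → (u ⊕ d) ⊕ (z ⊕ (u′ ⊕ (y ⊕ d′))) ⊜ ((z ⊕ y) ⊕ (u ⊕ u′)) ⊕ (d ⊕ d′)) ↭-refl
                (up a p k) (up b p k) (rect a p ℓ) (up a (k + p) (suc ℓ)) (rect a (ℓ + p) ℓ) (up b (k + p) (suc ℓ)))
      (++⁺ (++⁺ (↭-sym (rect-+ a p ℓ ℓ)) (column a)) (column b)))
    where
    column : ∀ x → up x p k ++ up x (k + p) (suc ℓ) ↭ up x p (ℓ + ℓ)
    column x = ↭-reflexive (trans (sym (up-+ x p k (suc ℓ))) (cong (up x p) (+-suc k ℓ)))

-- From two closed walks to a 2-factor with two cycles

mapWalk : ∀ {V : Set} {R S : V → V → Set} → (∀ {P Q} → R P Q → S P Q) →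
          ∀ {P Q l} → Walk R P l Q → Walk S P l Q
mapWalk f []      = []
mapWalk f (e ∷ w) = f e ∷ mapWalk f w

lookup-injective : ∀ {A : Set} {l : List A} → Unique l → ∀ i j → lookup l i ≡ lookup l j → i ≡ j
lookup-injective (d ∷ u) zero    zero    eq = refl
lookup-injective (d ∷ u) zero    (suc j) eq = contradiction eq (All.lookup d (∈-lookup j))
lookup-injective (d ∷ u) (suc i) zero    eq = contradiction (sym eq) (All.lookup d (∈-lookup i))
lookup-injective (d ∷ u) (suc i) (suc j) eq = cong suc (lookup-injective u i j eq)

Unique-++⁻ : ∀ {A : Set} (l : List A) {l′} → Unique (l ++ l′) → Unique l × Unique l′ × Disjoint l l′
Unique-++⁻ []      u       = [] , u , λ ()
Unique-++⁻ (x ∷ l) (d ∷ u) with Unique-++⁻ l u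
... | ul , ul′ , dis = All.++⁻ˡ l d ∷ ul , ul′ ,
  λ { (here refl , y) → All.lookup (All.++⁻ʳ l d) y refl ; (there x , y) → dis (x , y) }

module _ {V : Set} {_~_ : V → V → Set} where

  walk-adjacent : ∀ {P Q l} → Walk _~_ P l Q → (i j : Fin (length l)) →
                  suc (toℕ i) ≡ toℕ j → lookup l i ~ lookup l j
  walk-adjacent (e ∷ e′ ∷ w) zero    (suc zero) eq = e′
  walk-adjacent (e ∷ w)      (suc i) (suc j)    eq = walk-adjacent w i j (suc-injective eq)

  walk-last : ∀ {P Q l} → Walk _~_ P l Q → (i : Fin (length l)) →
              suc (toℕ i) ≡ length l → lookup l i ≡ Q
  walk-last (e ∷ [])     zero    eq = refl
  walk-last (e ∷ e′ ∷ w) (suc i) eq = walk-last (e′ ∷ w) i (suc-injective eq)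

  walk-first : ∀ {P Q l} → Walk _~_ P l Q → (i : Fin (length l)) → toℕ i ≡ 0 → P ~ lookup l i
  walk-first (e ∷ w) zero eq = e

module _ {A V : Set} {_~_ : V → V → Set} (φ : A → V) where

  closedWalk : ∀ {P Q l} → Walk (_~_ on φ) P l Q → φ P ≡ φ Q → 3 ≤ length l → Unique l →
               (∀ {x y} → x ∈ l → y ∈ l → φ x ≡ φ y → x ≡ y) → Cycle V _~_
  closedWalk {l = l} w closed long unique φ-inj = record
    { len      = length l
    ; len≥3    = long
    ; vert     = φ ∘ lookup l
    ; distinct = λ {i} {j} eq → lookup-injective unique i j (φ-inj (∈-lookup i) (∈-lookup j) eq)
    ; adjacent = λ where
        i j (inj₁ eq)       → walk-adjacent w i j eq
        -- The closing edge of the cycle is the first edge of the walk: its unlisted start `P` has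
        -- the same image as the last point `Q`.
        i j (inj₂ (eq , z)) → subst (_~ φ (lookup l j)) (trans closed (sym (cong φ (walk-last w i eq)))) (walk-first w j z) }

  -- D is a system of representatives for φ.
  twoWalks : ∀ {D l₁ l₂ P₁ Q₁ P₂ Q₂} → l₁ ++ l₂ ↭ D → Unique D →
             (∀ {x y} → x ∈ D → y ∈ D → φ x ≡ φ y → x ≡ y) →
             (∀ v → ∃[ x ] x ∈ D × φ x ≡ v) →
             Walk (_~_ on φ) P₁ l₁ Q₁ → φ P₁ ≡ φ Q₁ → 3 ≤ length l₁ →
             Walk (_~_ on φ) P₂ l₂ Q₂ → φ P₂ ≡ φ Q₂ → 3 ≤ length l₂ →
             ∀ {x y} → x ∈ l₁ → y ∈ l₂ →
             Σ (TwoCycle2Factor V _~_) λ F →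
               (φ x ∈Cycle TwoCycle2Factor.C₁ F) × (φ y ∈Cycle TwoCycle2Factor.C₂ F)
  twoWalks {D} {l₁} {l₂} perm uniqueD inj onto w₁ c₁ long₁ w₂ c₂ long₂ x∈ y∈ = record
      { C₁ = closedWalk w₁ c₁ long₁ unique₁ inj₁₁
      ; C₂ = closedWalk w₂ c₂ long₂ unique₂ inj₂₂
      ; disjoint = λ { w (i , eq) (j , eq′) → disj (∈-lookup i ,
          subst (_∈ l₂) (inj (right (∈-lookup j)) (left (∈-lookup i)) (trans eq′ (sym eq))) (∈-lookup j)) }
      ; spanning = λ v → let x , x∈D , eq = onto v in
           Sum.map (onCycle eq) (onCycle eq) (∈-++⁻ l₁ (∈-resp-↭ (↭-sym perm) x∈D))
      } , onCycle refl x∈ , onCycle refl y∈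
    where
    -- Both the absence of repetitions and the disjointness of the two lists come from uniqueness of
    -- `D`, transported along the permutation.
    parts = Unique-++⁻ l₁ (Unique-resp-↭ (setoid _) (↭⇒↭ₛ (↭-sym perm)) uniqueD)
    unique₁ = proj₁ parts
    unique₂ = proj₁ (proj₂ parts)
    disj = proj₂ (proj₂ parts)
    left : ∀ {x} → x ∈ l₁ → x ∈ D
    left x∈l = ∈-resp-↭ perm (∈-++⁺ˡ x∈l)
    right : ∀ {x} → x ∈ l₂ → x ∈ D
    right x∈l = ∈-resp-↭ perm (∈-++⁺ʳ l₁ x∈l)
    inj₁₁ : ∀ {x y} → x ∈ l₁ → y ∈ l₁ → φ x ≡ φ y → x ≡ y
    inj₁₁ p q = inj (left p) (left q)
    inj₂₂ : ∀ {x y} → x ∈ l₂ → y ∈ l₂ → φ x ≡ φ y → x ≡ y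
    inj₂₂ p q = inj (right p) (right q)
    onCycle : ∀ {l x v} → φ x ≡ v → x ∈ l → ∃[ i ] φ (lookup l i) ≡ v
    onCycle refl x∈l = index x∈l , cong φ (sym (lookup-index x∈l))

-- Membership and uniqueness in columns and rectangles

∈-up⁺ : ∀ {x p y} h → p < y → y ≤ h + p → (x , y) ∈ up x p h
∈-up⁺ zero p<y y≤ = contradiction p<y (≤⇒≯ y≤)
∈-up⁺ {x} {p} (suc h) p<y y≤ with m≤n⇒m<n∨m≡n y≤
... | inj₁ (s≤s y<) = ∈-++⁺ˡ (∈-up⁺ h p<y y<)
... | inj₂ refl     = ∈-++⁺ʳ (up x p h) (here refl)

∈-up⁻ : ∀ {x p P} h → P ∈ up x p h → proj₁ P ≡ x × p < proj₂ P × proj₂ P ≤ h + p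
∈-up⁻ {x} {p} (suc h) P∈ with ∈-++⁻ (up x p h) P∈
... | inj₁ P∈up with ∈-up⁻ h P∈up
...   | eq , lo , hi = eq , lo , m≤n⇒m≤1+n hi
∈-up⁻ {x} {p} (suc h) P∈ | inj₂ (here refl) = refl , s≤s (m≤n+m p h) , ≤-refl

∈-rect⁺ : ∀ {x p y} w h → x < w → p < y → y ≤ h + p → (x , y) ∈ rect w p h
∈-rect⁺ {x} {p} (suc w) h (s≤s x≤w) p<y y≤ with m≤n⇒m<n∨m≡n x≤w
... | inj₁ x<w  = ∈-++⁺ˡ (∈-rect⁺ w h x<w p<y y≤)
... | inj₂ refl = ∈-++⁺ʳ (rect w p h) (∈-up⁺ h p<y y≤)

∈-rect⁻ : ∀ {p P} w h → P ∈ rect w p h → proj₁ P < w × p < proj₂ P × proj₂ P ≤ h + p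
∈-rect⁻ {p} (suc w) h P∈ with ∈-++⁻ (rect w p h) P∈
... | inj₁ P∈rect with ∈-rect⁻ w h P∈rect
...   | x<w , bounds = m≤n⇒m≤1+n x<w , bounds
∈-rect⁻ {p} (suc w) h P∈ | inj₂ P∈up with ∈-up⁻ h P∈up
...   | refl , bounds = ≤-refl , bounds

up-unique : ∀ x p h → Unique (up x p h)
up-unique x p zero    = []
up-unique x p (suc h) = Unique.++⁺ (up-unique x p h) ([] ∷ [])
  λ { (P∈ , here refl) → 1+n≰n (proj₂ (proj₂ (∈-up⁻ h P∈))) }

rect-unique : ∀ w p h → Unique (rect w p h)
rect-unique zero    p h = []
rect-unique (suc w) p h = Unique.++⁺ (rect-unique w p h) (up-unique w p h)
  λ { (P∈ , P∈′) → <-irrefl (proj₁ (∈-up⁻ h P∈′)) (proj₁ (∈-rect⁻ w h P∈)) }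

-- Parity and residues

even-or-suc : ∀ x → Even x ⊎ Even (suc x)
even-or-suc zero    = inj₁ (divides 0 refl)
even-or-suc (suc x) = [ inj₂ ∘ ∣m∣n⇒∣m+n ∣-refl , inj₁ ]′ (even-or-suc x)

odd⇒even-suc : ∀ {x} → Odd x → Even (suc x)
odd⇒even-suc {x} o = [ (λ e → contradiction e o) , (λ e → e) ]′ (even-or-suc x)

≡mod-from-multiples : ∀ n x y q q′ → x + q * n ≡ y + q′ * n → x ≡ y [mod n ]
≡mod-from-multiples n x y q q′ eq with ≤-total q q′
... | inj₁ q≤q′ with r , refl ← m≤n⇒∃[o]m+o≡n q≤q′ =
  inj₁ (r , +-cancelʳ-≡ (q * n) x (y + r * n) (trans eq (shuffle y q r n)))
  where
  shuffle : ∀ y q r n → y + (q + r) * n ≡ y + r * n + q * n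
  shuffle = solve-∀
... | inj₂ q′≤q with r , refl ← m≤n⇒∃[o]m+o≡n q′≤q =
  inj₂ (r , +-cancelʳ-≡ (q′ * n) y (x + r * n) (trans (sym eq) (shuffle x q′ r n)))
  where
  shuffle : ∀ y q r n → y + (q + r) * n ≡ y + r * n + q * n
  shuffle = solve-∀

even-≡mod2 : ∀ {x y} → Even x → Even y → x ≡ y [mod 2 ]
even-≡mod2 (divides-refl p) (divides-refl q) = ≡mod-from-multiples 2 (p * 2) (q * 2) q p (+-comm (p * 2) (q * 2))

module _ (n : ℕ) .{{_ : NonZero n}} where

  toℕ-mod : ∀ x → toℕ (x mod n) ≡ x % n
  toℕ-mod x = toℕ-fromℕ< (m%n<n x n)

  mod-cong : ∀ {x y} → x % n ≡ y % n → x mod n ≡ y mod n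
  mod-cong {x} {y} eq = toℕ-injective (trans (toℕ-mod x) (trans eq (sym (toℕ-mod y))))

  mod-injective : ∀ {x y} → x mod n ≡ y mod n → x % n ≡ y % n
  mod-injective {x} {y} eq = trans (sym (toℕ-mod x)) (trans (cong toℕ eq) (toℕ-mod y))

  -- If `y` is `x + e`, equal remainders give `n ∣ e`, whereas `e ≤ y < n`; hence `e` is zero.
  +-window-injective : ∀ c {x y} → x < n → y < n → (c + x) % n ≡ (c + y) % n → x ≡ y
  +-window-injective c {x} {y} x<n y<n eq =
    [ (λ x≤y → ordered x≤y y<n eq) , (λ y≤x → sym (ordered y≤x x<n (sym eq))) ]′ (≤-total x y)
    where
    open ≡-Reasoning
    ordered : ∀ {x y} → x ≤ y → y < n → (c + x) % n ≡ (c + y) % n → x ≡ y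
    ordered {x} x≤y y<n eq with m≤n⇒∃[o]m+o≡n x≤y
    ... | zero , refl = sym (+-identityʳ x)
    ... | e@(suc _) , refl = contradiction (∣⇒≤ n∣e) (<⇒≱ (≤-<-trans (m≤n+m e x) y<n))
      where
      q = (c + x) / n
      q′ = (c + (x + e)) / n
      n∣e : n ∣ e
      n∣e = ∣m+n∣m⇒∣n {m = q * n} {n = e} (divides q′ (+-cancelˡ-≡ ((c + x) % n) _ _ (begin
        (c + x) % n + (q * n + e)       ≡⟨ +-assoc ((c + x) % n) (q * n) e ⟨
        ((c + x) % n + q * n) + e       ≡⟨ cong (_+ e) (m≡m%n+[m/n]*n (c + x) n) ⟨
        c + x + e                       ≡⟨ +-assoc c x e ⟩
        c + (x + e)                     ≡⟨ m≡m%n+[m/n]*n (c + (x + e)) n ⟩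
        (c + (x + e)) % n + q′ * n      ≡⟨ cong (_+ q′ * n) eq ⟨
        (c + x) % n + q′ * n            ∎))) (n∣m*n q)

  +-window-surjective : ∀ c (r : Fin n) → ∃[ x ] x < n × (c + x) mod n ≡ r
  +-window-surjective c r = x % n , m%n<n x n , toℕ-injective (begin
    toℕ ((c + x % n) mod n)      ≡⟨ toℕ-mod _ ⟩
    (c + x % n) % n              ≡⟨ %-distribˡ-+ c (x % n) n ⟩
    (c % n + x % n % n) % n      ≡⟨ cong (λ t → (c % n + t) % n) (m%n%n≡m%n x n) ⟩
    (c % n + x % n) % n          ≡⟨ %-distribˡ-+ c x n ⟨
    (c + x) % n                  ≡⟨ cong (_% n) (trans (shuffle c (toℕ r) (pred n)) (cong (λ t → toℕ r + c * t) (suc-pred n))) ⟩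
    (toℕ r + c * n) % n          ≡⟨ [m+kn]%n≡m%n (toℕ r) c n ⟩
    toℕ r % n                    ≡⟨ m<n⇒m%n≡m (toℕ<n r) ⟩
    toℕ r                        ∎)
    where
    open ≡-Reasoning
    -- Congruent to `r − c` modulo `n`, without subtraction.
    x = toℕ r + c * pred n
    shuffle : ∀ c r p → c + (r + c * p) ≡ r + c * suc p
    shuffle = solve-∀

  divmod-unique : ∀ r q → r < n → (r + q * n) % n ≡ r × (r + q * n) / n ≡ q
  divmod-unique r q r<n = trans ([m+kn]%n≡m%n r q n) (m<n⇒m%n≡m r<n) ,
    trans (+-distrib-/-∣ʳ r (n∣m*n q)) (cong₂ _+_ (m<n⇒m/n≡0 r<n) (m*n/n≡m q n))

-- The toroidal graph as a quotient of the unrolled graph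

module Torus (m n ℓ : ℕ) .{{_ : NonZero m}} .{{_ : NonZero n}}
             (evenm : Even m) (evenn : Even n) (evenℓ : Even ℓ) where

  V : Set
  V = HTGVertex m n

  row : ℕ → ℕ → ℕ
  row q y = y + q * ℓ

  -- The unrolled graph: crossing a jump edge adds ℓ to the row, so both flat and jump edges lift
  -- to edges (x , y) – (x + 1 , y) with x + y odd.
  π : Point → V
  π (x , y) = x mod m , row (x / m) y mod n

  π-+m : ∀ x y → π (m + x , y) ≡ π (x , ℓ + y)
  π-+m x y = cong₂ _,_ (mod-cong m (%-remove-+ˡ x ∣-refl))
    (cong (_mod n) (trans
      (cong (λ q → row q y) (trans (+-distrib-/-∣ˡ x ∣-refl) (cong (_+ x / m) (n/n≡1 m))))
      (shuffle y (x / m) ℓ)))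
    where
    shuffle : ∀ y q ℓ → y + (1 + q) * ℓ ≡ ℓ + y + q * ℓ
    shuffle = solve-∀

  π-+n : ∀ x y → π (x , n + y) ≡ π (x , y)
  π-+n x y = cong (x mod m ,_) (mod-cong n
    (trans (cong (_% n) (+-assoc n y (x / m * ℓ))) (%-remove-+ˡ _ ∣-refl)))

  π-vertical : ∀ x y → HTGArc m n ℓ (π (x , y)) (π (x , suc y))
  π-vertical x y = vertical (≡mod-from-multiples n _ _ (suc Y / n) (Y / n) (begin
    toℕ (suc Y mod n) + suc Y / n * n ≡⟨ cong (_+ suc Y / n * n) (toℕ-mod n (suc Y)) ⟩
    suc Y % n + suc Y / n * n         ≡⟨ m≡m%n+[m/n]*n (suc Y) n ⟨
    suc Y                             ≡⟨ cong suc (m≡m%n+[m/n]*n Y n) ⟩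
    suc (Y % n) + Y / n * n           ≡⟨ cong (λ t → suc t + Y / n * n) (toℕ-mod n Y) ⟨
    suc (toℕ (Y mod n)) + Y / n * n   ∎))
    where
    open ≡-Reasoning
    Y = row (x / m) y

  -- Because `m`, `n` and `ℓ` are all even, neither the reductions nor the twist changes the parity
  -- of `x + y`.
  π-parity : ∀ x y → Even (x % m + row (x / m) y % n) → Even (x + y)
  π-parity x y e = ∣m+n∣m⇒∣n (subst Even (trans (sym eq) (+-comm (x + y) _)) (even-+ e (even-+ (∣n⇒∣m*n q evenm) (∣n⇒∣m*n (Y / n) evenn))))
                             (∣n⇒∣m*n q evenℓ)
    where
    open ≡-Reasoning
    q = x / m
    Y = row q y
    shuffle : ∀ r s t u → (r + s) + (t + u) ≡ (r + t) + (s + u)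
    shuffle = solve-∀
    eq : x + y + q * ℓ ≡ (x % m + Y % n) + (q * m + Y / n * n)
    eq = begin
      x + y + q * ℓ                             ≡⟨ +-assoc x y _ ⟩
      x + Y                                     ≡⟨ cong₂ _+_ (m≡m%n+[m/n]*n x m) (m≡m%n+[m/n]*n Y n) ⟩
      (x % m + q * m) + (Y % n + Y / n * n)     ≡⟨ shuffle (x % m) (q * m) (Y % n) _ ⟩
      (x % m + Y % n) + (q * m + Y / n * n)     ∎

  -- The image is a flat edge unless `x` reduces to the last column; there the quotient grows by one
  -- and the image is a jump edge.
  π-flat : ∀ x y → Odd (x + y) → HTGArc m n ℓ (π (x , y)) (π (suc x , y))
  π-flat x y odd with m≤n⇒m<n∨m≡n (m%n<n x m)
  ... | inj₁ r+1<m = subst (λ q′ → HTGArc m n ℓ (π (x , y)) (suc x mod m , row q′ y mod n)) (sym same-q)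
      (flat (trans (toℕ-mod m (suc x)) (trans same-r (cong suc (sym (toℕ-mod m x)))))
            (odd ∘ π-parity x y ∘ subst Even (cong₂ _+_ (toℕ-mod m x) (toℕ-mod n (row q y)))))
    where
    q = x / m
    x+1≡ : suc x ≡ suc (x % m) + q * m
    x+1≡ = cong suc (m≡m%n+[m/n]*n x m)
    same-r : suc x % m ≡ suc (x % m)
    same-r = trans (cong (_% m) x+1≡) (proj₁ (divmod-unique m _ q r+1<m))
    same-q : suc x / m ≡ q
    same-q = trans (cong (_/ m) x+1≡) (proj₂ (divmod-unique m _ q r+1<m))
  ... | inj₂ r+1≡m = subst (λ q′ → HTGArc m n ℓ (π (x , y)) (suc x mod m , row q′ y mod n)) (sym next-q)
      (jump (trans (cong suc (toℕ-mod m x)) r+1≡m) (trans (toℕ-mod m (suc x)) next-r)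
            (≡mod-from-multiples n _ _ (Y′ / n) (Y / n) rows)
            (even-≡mod2 (subst Even (sym (toℕ-mod n Y)) (%-presˡ-∣ evenY evenn)) evenm))
    where
    open ≡-Reasoning
    q = x / m
    Y = row q y
    Y′ = row (suc q) y
    x+1≡ : suc x ≡ suc q * m
    x+1≡ = trans (cong suc (m≡m%n+[m/n]*n x m)) (cong (_+ q * m) r+1≡m)
    next-r : suc x % m ≡ 0
    next-r = trans (cong (_% m) x+1≡) (m*n%n≡0 (suc q) m)
    next-q : suc x / m ≡ suc q
    next-q = trans (cong (_/ m) x+1≡) (m*n/n≡m (suc q) m)
    evenY : Even Y
    -- `suc x` is a multiple of `m`, so `x` is odd and `y` must be even.
    evenY = even-+ (∣m+n∣m⇒∣n (odd⇒even-suc odd) (subst Even (sym x+1≡) (∣n⇒∣m*n (suc q) evenm))) (∣n⇒∣m*n q evenℓ)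
    shuffle₁ : ∀ y q ℓ → y + (1 + q) * ℓ ≡ (y + q * ℓ) + ℓ
    shuffle₁ = solve-∀
    shuffle₂ : ∀ r s t → (r + s) + t ≡ (r + t) + s
    shuffle₂ = solve-∀
    rows : toℕ (Y′ mod n) + Y′ / n * n ≡ toℕ (Y mod n) + ℓ + Y / n * n
    rows = begin
      toℕ (Y′ mod n) + Y′ / n * n     ≡⟨ cong (_+ Y′ / n * n) (toℕ-mod n Y′) ⟩
      Y′ % n + Y′ / n * n             ≡⟨ m≡m%n+[m/n]*n Y′ n ⟨
      Y′                              ≡⟨ shuffle₁ y q ℓ ⟩
      Y + ℓ                           ≡⟨ cong (_+ ℓ) (m≡m%n+[m/n]*n Y n) ⟩
      Y % n + Y / n * n + ℓ           ≡⟨ shuffle₂ (Y % n) _ ℓ ⟩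
      Y % n + ℓ + Y / n * n           ≡⟨ cong (λ t → t + ℓ + Y / n * n) (toℕ-mod n Y) ⟨
      toℕ (Y mod n) + ℓ + Y / n * n   ∎

  shift : ℕ → ℕ → Point → Point
  shift c d (x , y) = c + x , d + y

  private
    row-shift : ∀ q d y → row q (d + suc y) ≡ suc (d + q * ℓ) + y
    row-shift q d y = eq q d y ℓ
      where
      eq : ∀ q d y ℓ → d + suc y + q * ℓ ≡ suc (d + q * ℓ) + y
      eq = solve-∀

  -- The column is recovered first. It fixes the quotient `q`, and then the rows 1 to `n` form a
  -- window of `n` consecutive integers starting at `suc (d + q * ℓ)`.
  π-shift-injective : ∀ c d {P Q} → proj₁ P < m × 0 < proj₂ P × proj₂ P ≤ n →
                      proj₁ Q < m × 0 < proj₂ Q × proj₂ Q ≤ n →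
                      π (shift c d P) ≡ π (shift c d Q) → P ≡ Q
  π-shift-injective c d {x , suc y} {x′ , suc y′} (x<m , _ , y<n) (x′<m , _ , y′<n) eq
    with eqx , eqy ← ,-injective eq
    with refl ← +-window-injective m c x<m x′<m (mod-injective m eqx) =
    cong (λ t → x , suc t) (+-window-injective n (suc (d + q * ℓ)) y<n y′<n
      (subst₂ (λ t t′ → t % n ≡ t′ % n) (row-shift q d y) (row-shift q d y′) (mod-injective n eqy)))
    where q = (c + x) / m

  π-shift-surjective : ∀ c d v → ∃[ P ] (proj₁ P < m × 0 < proj₂ P × proj₂ P ≤ n) × π (shift c d P) ≡ v
  π-shift-surjective c d (i , j)
    with x , x<m , refl ← +-window-surjective m c i
    with y , y<n , refl ← +-window-surjective n (suc (d + (c + x) / m * ℓ)) j =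
    (x , suc y) , (x<m , s≤s z≤n , y<n) , cong (λ t → (c + x) mod m , t mod n) (row-shift ((c + x) / m) d y)

-- The translates of one 2-factor separate any two vertices

length-up : ∀ x p k → length (up x p k) ≡ k
length-up x p zero    = refl
length-up x p (suc k) = trans (length-++ (up x p k)) (trans (+-comm _ 1) (cong suc (length-up x p k)))

module Separation (M k A B n : ℕ) .{{_ : NonZero n}} (2≤k : 2 ≤ k) (evenℓ : Even (2 + k))
  (n≡ : n ≡ (2 + k) + (2 + k) + (A * (2 + k) + B * (4 + k))) where

  -- From here on `ℓ` is `2 + k`, and the ring occupies rows 1 to `suc k`.
  open Strip M (suc k) evenℓ

  evenm : Even m
  evenm = even-cols (suc M)

  evenn : Even n
  evenn = subst Even (sym n≡) (even-+ (even-+ evenℓ evenℓ) (even-+ (∣n⇒∣m*n A evenℓ) (∣n⇒∣m*n B even-2+ℓ)))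

  open Torus m n ℓ evenm evenn evenℓ

  2ℓ≤n : ℓ + ℓ ≤ n
  2ℓ≤n = ≤-trans (m≤m+n (ℓ + ℓ) _) (≤-reflexive (sym n≡))

  tail : Block (ℓ + ℓ + 0) (A * ℓ + B * (2 + ℓ))
  tail = stack (iterate evenℓ straightBlock A even-start)
               (iterate even-2+ℓ climbingBlock B (even-+ (∣n⇒∣m*n A evenℓ) even-start))
    where
    even-start : Even (ℓ + ℓ + 0)
    even-start = even-+ (even-+ evenℓ evenℓ) (divides 0 refl)

  rest : List Point
  rest = detour 0 ++ Block.points tail

  restWalk : Walk Adj (b , 0) rest (b , n)
  restWalk = detourWalk (divides 0 refl) ◅◅ endsAt (trans (eq (A * ℓ + B * (2 + ℓ)) (ℓ + ℓ)) (sym n≡)) (Block.walk tail)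
    where
    eq : ∀ s t → s + (t + 0) ≡ t + s
    eq = solve-∀

  ring-rest : ring 0 ++ rest ↭ rect m 0 n
  ring-rest = ↭-trans (↭-reflexive (sym (++-assoc (ring 0) (detour 0) _)))
    (↭-trans (++⁺ (ring-detour 0) (Block.fills tail)) 
      (↭-trans (↭-sym (rect-+ m 0 (ℓ + ℓ) _)) (↭-reflexive (cong (rect m 0) (sym n≡)))))

  -- The ring spans an odd number of rows, so its bottom and its top row both carry a flat edge
  -- between columns `a` and `b`.
  ringWalk : Walk Adj (b , 1) (ring 0) (b , 1)
  ringWalk = upWalk k (inj₂ (flat-bottom (even-cols M) (divides 0 refl))) ◅◅
    downWalk k (inj₁ (flat (subst Odd (sym (+-suc a (k + 0)))
      (odd-suc (even-+ (even-cols M) (subst Even (sym (+-identityʳ k)) (∣m+n∣m⇒∣n evenℓ ∣-refl)))))))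

  InRing Inside : Point → Set
  InRing (x , y) = (x ≡ a ⊎ x ≡ b) × 0 < y × y ≤ suc k
  Inside (x , y) = x < m × 0 < y × y ≤ n

  ∈ring⁺ : ∀ {P} → InRing P → P ∈ ring 0
  ∈ring⁺ (inj₁ refl , lo , hi) = ∈-++⁺ˡ (∈-up⁺ (suc k) lo (≤-trans hi (m≤m+n _ 0)))
  ∈ring⁺ (inj₂ refl , lo , hi) = ∈-++⁺ʳ (up a 0 (suc k))
    (∈-resp-↭ (↭-sym (down↭up b 0 (suc k))) (∈-up⁺ (suc k) lo (≤-trans hi (m≤m+n _ 0))))

  ∈ring⁻ : ∀ {P} → P ∈ ring 0 → InRing P
  ∈ring⁻ P∈ with ∈-++⁻ (up a 0 (suc k)) P∈
  ... | inj₁ P∈up with refl , lo , hi ← ∈-up⁻ (suc k) P∈up = inj₁ refl , lo , ≤-trans hi (≤-reflexive (+-identityʳ (suc k)))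
  ... | inj₂ P∈down with refl , lo , hi ← ∈-up⁻ (suc k) (∈-resp-↭ (down↭up b 0 (suc k)) P∈down) =
    inj₂ refl , lo , ≤-trans hi (≤-reflexive (+-identityʳ (suc k)))

  Inside⇒∈rect : ∀ {P} → Inside P → P ∈ rect m 0 n
  Inside⇒∈rect (x<m , lo , hi) = ∈-rect⁺ m n x<m lo (≤-trans hi (m≤m+n n 0))

  ∈rect⇒Inside : ∀ {P} → P ∈ rect m 0 n → Inside P
  ∈rect⇒Inside P∈ with x<m , lo , hi ← ∈-rect⁻ m n P∈ = x<m , lo , ≤-trans hi (≤-reflexive (+-identityʳ n))

  ring⊎rest : ∀ {P} → Inside P → InRing P ⊎ P ∈ rest
  ring⊎rest {P} inside =
    Sum.map₁ ∈ring⁻ (∈-++⁻ (ring 0) (∈-resp-↭ (↭-sym ring-rest) (Inside⇒∈rect inside)))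

  Separated : V → V → Set
  Separated u v = Σ (TwoCycle2Factor V (HTGAdj m n ℓ)) λ F →
    (u ∈Cycle TwoCycle2Factor.C₁ F) × (v ∈Cycle TwoCycle2Factor.C₂ F)

  module _ (c d : ℕ) (even-shift : Even (c + d)) where

    φ : Point → V
    φ = π ∘ shift c d

    -- An even translation keeps the parity of `x + y`. A translated jump is a horizontal edge into
    -- column `c + m`, which `π-+m` identifies with column `c`, `ℓ` rows higher.
    φ-arc : ∀ {P Q} → Arc P Q → HTGArc m n ℓ (φ P) (φ Q)
    φ-arc {x , y} vertical = subst (λ t → HTGArc m n ℓ (φ (x , y)) (π (c + x , t))) (sym (+-suc d y)) (π-vertical (c + x) (d + y))
    φ-arc {x , y} (flat odd) = subst (λ t → HTGArc m n ℓ (φ (x , y)) (π (t , d + y))) (sym (+-suc c x))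
      (π-flat (c + x) (d + y) λ e → odd (∣m+n∣m⇒∣n (subst Even (shuffle c d x y) e) even-shift))
      where
      shuffle : ∀ c d x y → (c + x) + (d + y) ≡ (c + d) + (x + y)
      shuffle = solve-∀
    φ-arc {_ , y} (jump even-y) = subst (HTGArc m n ℓ (φ (b , y)))
      (trans (cong (λ t → π (t , d + y)) (shuffle₁ c b))
        (trans (π-+m c (d + y)) (cong₂ (λ s t → π (s , t)) (sym (+-identityʳ c)) (shuffle₂ ℓ d y))))
      (π-flat (c + b) (d + y) λ e →
        odd-suc (even-+ even-shift (even-+ (even-cols M) even-y)) (subst Even (shuffle₃ c d a y) e))
      where
      shuffle₁ : ∀ c b → suc (c + b) ≡ suc b + c
      shuffle₁ = solve-∀
      shuffle₂ : ∀ ℓ d y → ℓ + (d + y) ≡ d + (ℓ + y)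
      shuffle₂ = solve-∀
      shuffle₃ : ∀ c d a y → (c + suc a) + (d + y) ≡ suc ((c + d) + (a + y))
      shuffle₃ = solve-∀

    φ-adj : ∀ {P Q} → Adj P Q → HTGAdj m n ℓ (φ P) (φ Q)
    φ-adj = Sum.map φ-arc φ-arc

    separate : ∀ {P Q} → InRing P → Q ∈ rest → Separated (φ P) (φ Q)
    separate P∈ Q∈ = twoWalks φ ring-rest (rect-unique m 0 n)
      (λ P∈D Q∈D → π-shift-injective c d (∈rect⇒Inside P∈D) (∈rect⇒Inside Q∈D))
      (λ v → let P , inside , eq = π-shift-surjective c d v in P , Inside⇒∈rect inside , eq)
      (mapWalk φ-adj ringWalk) refl
      -- Column `a` alone contributes `suc k ≥ 3` points to the ring, and below `suc ℓ` points to
      -- the detour.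
      (≤-trans (s≤s 2≤k) (≤-trans (≤-reflexive (sym (length-up a 0 (suc k)))) (length-++-≤ˡ (up a 0 (suc k)))))
      (mapWalk φ-adj restWalk) (sym (trans (cong (λ t → π (c + b , t)) (+-comm d n)) 
         (trans (π-+n (c + b) d) (cong (λ t → π (c + b , t)) (sym (+-identityʳ d))))))
      (≤-trans (s≤s (s≤s (s≤s z≤n))) (≤-trans (≤-reflexive (sym (length-up a (suc k + 0) (suc ℓ))))
         (≤-trans (length-++-≤ˡ (up a (suc k + 0) (suc ℓ)))
         (≤-trans (length-++-≤ʳ _ {zig M 0 ℓ}) (length-++-≤ˡ (detour 0))))))
      (∈ring⁺ P∈) Q∈

  -- Reduces separation to finding coordinates of both vertices relative to one translate; the ring
  -- and the rest exhaust the rectangle, so it is enough that `Q` avoids the ring.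
  separateBy : ∀ {u v} c d → Even (c + d) → ∀ {P Q} → InRing P → Inside Q → ¬ InRing Q →
               π (shift c d P) ≡ u → π (shift c d Q) ≡ v → Separated u v
  separateBy c d even P∈ inside Q∉ refl refl =
    separate c d even P∈ ([ (λ Q∈ → contradiction Q∈ Q∉) , (λ Q∈ → Q∈) ]′ (ring⊎rest inside))

  π-row : ∀ x {y y′} → y ≡ n + y′ → π (x , y) ≡ π (x , y′)
  π-row x refl = π-+n x _

  π-col : ∀ {x x′ y y′} → x ≡ m + x′ → ℓ + y ≡ n + y′ → π (x , y) ≡ π (x′ , y′)
  π-col {x′ = x′} refl eq = trans (π-+m x′ _) (π-row x′ eq)

  even-k : Even k
  even-k = ∣m+n∣m⇒∣n evenℓ ∣-refl

  even-complement : ∀ {s t} → s + t ≡ n → Even s → Even t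
  even-complement {s} eq es = ∣m+n∣m⇒∣n (subst Even (sym eq) evenn) es

  complement : ∀ {s} → s ≤ ℓ + ℓ → ∃[ t ] s + t ≡ n
  complement s≤ = m≤n⇒∃[o]m+o≡n (≤-trans s≤ 2ℓ≤n)

  -- Lowering the ring by k = ℓ − 2 rows turns its bottom row into its top row.
  lowerRing : ∀ c d → Even (c + d) → ∀ {z x y} → z ≡ a ⊎ z ≡ b → InRing (x , y) → x < m → 1 < y →
              Separated (π (shift c d (z , 1))) (π (shift c d (x , y)))
  lowerRing c d even {z} {x} {y} z∈ (_ , 0<y , y≤k+1) x<m 1<y
    -- Adding `t`, which is `n − k`, lowers by `k` modulo `n`; `t` is even because `k` and `n` are.
    with t , eq ← complement {k} (≤-trans (m≤n+m k 2) (m≤m+n ℓ ℓ)) =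
    separateBy c (d + t) (subst Even (+-assoc c d t) (even-+ even (even-complement eq even-k)))
      {z , 1 + k} {x , y + k}
      (z∈ , s≤s z≤n , ≤-refl)
      (x<m , ≤-trans 0<y (m≤m+n y k) , ≤-trans (+-mono-≤ (m≤n⇒m≤1+n y≤k+1) (m≤n+m k 2)) 2ℓ≤n)
      (λ (_ , _ , y+k≤) → contradiction y+k≤ (<⇒≱ (+-monoˡ-≤ k 1<y)))
      (lowered z 1) (lowered x y)
    where
    shuffle : ∀ d t y k → d + t + (y + k) ≡ (k + t) + (d + y)
    shuffle = solve-∀
    lowered : ∀ x y → π (shift c (d + t) (x , y + k)) ≡ π (shift c d (x , y))
    lowered x y = π-row (c + x) (trans (shuffle d t y k) (cong (_+ (d + y)) eq))

  -- The ring moves one column left and one row down. The first vertex becomes `(b , 2)`; the second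
  -- lies to the right of the ring, across the jump, at `(0 , 2 + ℓ)`.
  separateRight : ∀ c d → Even (c + d) → Separated (π (shift c d (a , 1))) (π (shift c d (b , 1)))
  separateRight c d even with t , eq ← complement {ℓ + 1} (+-monoʳ-≤ ℓ (s≤s z≤n)) =
    -- Adding `m − 1` columns and `n − ℓ − 1` rows amounts to subtracting one of each, since a full
    -- turn of `m` columns is worth `ℓ` rows.
    separateBy (c + b) (d + t)
      (subst Even (shuffle₁ c d a t) (even-+ even (even-+ (even-cols M)
        (even-complement (trans (sym (+-assoc ℓ 1 t)) eq) evenℓ))))
      {b , 2} {0 , 2 + ℓ}
      (inj₂ refl , s≤s z≤n , s≤s (≤-trans (s≤s z≤n) 2≤k))
      (s≤s z≤n , s≤s z≤n , ≤-trans (+-monoˡ-≤ ℓ (s≤s (s≤s z≤n))) 2ℓ≤n)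
      (λ (_ , _ , hi) → 1+n≰n (≤-trans (m≤n+m _ 2) hi))
      (π-col (shuffle₂ c a) (trans (shuffle₃ ℓ d t) (cong (_+ (d + 1)) eq)))
      (trans (cong (λ x → π (x , d + t + (2 + ℓ))) (+-identityʳ (c + b)))
        (π-row (c + b) (trans (shuffle₄ ℓ d t) (cong (_+ (d + 1)) eq))))
    where
    shuffle₁ : ∀ c d a t → (c + d) + (a + (1 + t)) ≡ (c + (1 + a)) + (d + t)
    shuffle₁ = solve-∀
    shuffle₂ : ∀ c a → c + (1 + a) + (1 + a) ≡ 2 + a + (c + a)
    shuffle₂ = solve-∀
    shuffle₃ : ∀ ℓ d t → ℓ + (d + t + 2) ≡ ℓ + 1 + t + (d + 1)
    shuffle₃ = solve-∀
    shuffle₄ : ∀ ℓ d t → d + t + (2 + ℓ) ≡ ℓ + 1 + t + (d + 1)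
    shuffle₄ = solve-∀

  -- Mirror image: the ring moves one column right and one row down, the first vertex becomes
  -- `(a , 2)`, and the second lies to the left of the ring.
  separateLeft : ∀ c d → Even (c + d) → Separated (π (shift c d (b , 1))) (π (shift c d (a , 1)))
  separateLeft c d even with t , eq ← complement {1} (s≤s z≤n) = [ single , several ]′ (zero-or-suc a)
    where
    zero-or-suc : ∀ x → x ≡ 0 ⊎ (∃[ y ] x ≡ suc y)
    zero-or-suc zero    = inj₁ refl
    zero-or-suc (suc x) = inj₂ (x , refl)
    shuffle₁ : ∀ c d t → (c + d) + (1 + t) ≡ (c + 1) + (d + t)
    shuffle₁ = solve-∀
    shuffle₂ : ∀ d t → d + t + 2 ≡ 1 + t + (d + 1)
    shuffle₂ = solve-∀
    even′ : Even (c + 1 + (d + t))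
    even′ = subst Even (shuffle₁ c d t) (even-+ even (subst Even (sym eq) evenn))
    u∈ : InRing (a , 2)
    u∈ = inj₁ refl , s≤s z≤n , s≤s (≤-trans (s≤s z≤n) 2≤k)
    moved : ∀ x → π (c + 1 + x , d + t + 2) ≡ π (shift c d (suc x , 1))
    moved x = trans (cong (λ z → π (z , d + t + 2)) (+-assoc c 1 x))
      (π-row (c + suc x) (trans (shuffle₂ d t) (cong (_+ (d + 1)) eq)))
    several : (∃[ a′ ] a ≡ suc a′) → _
    several (a′ , a≡) = separateBy (c + 1) (d + t) even′ {a , 2} {a′ , 2} u∈
      (≤-trans (≤-reflexive (sym a≡)) (m≤n+m a 2) , s≤s z≤n , ≤-trans (s≤s (s≤s z≤n)) 2ℓ≤n)
      (λ { (inj₁ a′≡a , _) → 1+n≢n (sym (trans a′≡a a≡))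
         ; (inj₂ a′≡b , _) → m+1+n≢n 1 (sym (trans a′≡b (cong suc a≡))) })
      (moved a) (trans (moved a′) (cong (λ z → π (shift c d (z , 1))) (sym a≡)))
    -- With only two columns, the left neighbour of column `a` is column `b` across the jump. The
    -- second vertex is then `(b , 2 + s)` with `s = n − ℓ ≥ ℓ`, hence above the ring.
    single : a ≡ 0 → _
    single a≡0 with s , eq′ ← complement {ℓ} (m≤m+n ℓ ℓ) =
      separateBy (c + 1) (d + t) even′ {a , 2} {b , 2 + s} u∈
        (≤-refl , s≤s z≤n , ≤-trans (+-monoˡ-≤ s (s≤s (s≤s z≤n))) (≤-reflexive eq′))
        (λ (_ , _ , hi) → 1+n≰n (≤-trans (s≤s (≤-trans
          (+-cancelˡ-≤ ℓ ℓ s (≤-trans 2ℓ≤n (≤-reflexive (sym eq′)))) (m≤n+m s 1))) (m≤n⇒m≤1+n hi)))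
        (moved a)
        (trans (π-col (trans (cong (λ z → c + 1 + suc z) a≡0) (trans (shuffle₃ c) (cong (λ z → 2 + z + (c + z)) (sym a≡0))))
                 (trans (shuffle₄ ℓ d t s) (cong₂ (λ i j → i + (j + (d + 1))) eq′ eq)))
               (π-row (c + a) refl))
      where
      shuffle₃ : ∀ c → c + 1 + 1 ≡ 2 + (c + 0)
      shuffle₃ = solve-∀
      shuffle₄ : ∀ ℓ d t s → ℓ + (d + t + (2 + s)) ≡ (ℓ + s) + ((1 + t) + (d + 1))
      shuffle₄ = solve-∀

  -- With the first vertex on a bottom corner, a vertex off the ring is separated at once and one
  -- higher on the ring by `lowerRing`; only the other bottom corner is left to `sep`.
  separateFrom : ∀ c d → Even (c + d) → ∀ z z′ → z ≡ a ⊎ z ≡ b → (∀ {x} → x ≡ a ⊎ x ≡ b → x ≡ z ⊎ x ≡ z′) →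
                 Separated (π (shift c d (z , 1))) (π (shift c d (z′ , 1))) →
                 ∀ {P} → Inside P → P ≢ (z , 1) → Separated (π (shift c d (z , 1))) (π (shift c d P))
  separateFrom c d even z z′ z∈ cols sep {x , y} inside@(x<m , 0<y , _) P≢ with ring⊎rest inside
  ... | inj₂ P∈rest = separate c d even (z∈ , s≤s z≤n , s≤s z≤n) P∈rest
  ... | inj₁ P∈ring@(x∈ , _) with m≤n⇒m<n∨m≡n 0<y | cols x∈
  ...   | inj₁ 1<y  | _         = lowerRing c d even z∈ P∈ring x<m 1<y
  ...   | inj₂ refl | inj₁ refl = contradiction refl P≢
  ...   | inj₂ refl | inj₂ refl = sep

  -- Only even translations are available, so parity decides whether `u` is placed on the left or on
  -- the right bottom corner of the ring.
  separated : ∀ u v → u ≢ v → Separated u v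
  separated u v u≢v with (c , d) , _ , u≡ ← π-shift-surjective a 1 u with even-or-suc (c + d)
  ... | inj₁ even with Q , inside , refl ← π-shift-surjective c d v =
    subst (λ w → Separated w (π (shift c d Q))) u≡′
      (separateFrom c d even a b (inj₁ refl) (λ x∈ → x∈) (separateRight c d even) inside
        (λ { refl → u≢v (sym u≡′) }))
    where
    u≡′ : π (shift c d (a , 1)) ≡ u
    u≡′ = trans (cong₂ (λ x y → π (x , y)) (+-comm c a) (+-comm d 1)) u≡
  -- Adding `b` columns and `n − ℓ` rows amounts to one column less, which corrects the parity and
  -- puts `u` at `(b , 1)`.
  ... | inj₂ odd with t , eq ← complement {ℓ} (m≤m+n ℓ ℓ)
      with Q , inside , refl ← π-shift-surjective (c + b) (d + t) v =
    subst (λ w → Separated w (π (shift (c + b) (d + t) Q))) u≡′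
      (separateFrom (c + b) (d + t) even b a (inj₂ refl) swap (separateLeft (c + b) (d + t) even) inside
        (λ { refl → u≢v (sym u≡′) }))
    where
    shuffle₁ : ∀ c d a t → (1 + (c + d)) + (a + t) ≡ (c + (1 + a)) + (d + t)
    shuffle₁ = solve-∀
    shuffle₂ : ∀ c a → c + (1 + a) + (1 + a) ≡ 2 + a + (a + c)
    shuffle₂ = solve-∀
    shuffle₃ : ∀ ℓ d t → ℓ + (d + t + 1) ≡ ℓ + t + (1 + d)
    shuffle₃ = solve-∀
    even : Even (c + b + (d + t))
    even = subst Even (shuffle₁ c d a t) (even-+ odd (even-+ (even-cols M) (even-complement eq evenℓ)))
    u≡′ : π (shift (c + b) (d + t) (b , 1)) ≡ u
    u≡′ = trans (π-col (shuffle₂ c a) (trans (shuffle₃ ℓ d t) (cong (_+ (1 + d)) eq))) u≡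

-- The arithmetic of the bound, and the conclusion

-- Every integer ≥ (L − 1) L is of the form A L + B (L + 1); apply this to N − 2L.
twoLengths : ∀ L N → 2 ≤ L → L * 2 * (L * 2) + 2 * (L * 2) < 2 * (N * 2) + 4 →
             ∃₂ λ A B → N * 2 ≡ L * 2 + L * 2 + (A * (L * 2) + B * (2 + L * 2))
twoLengths L@(suc L₁) N 2≤L bound = split (m≤n⇒∃[o]m+o≡n L²+L≤N)
  where
  double : ∀ L → L * 2 * (L * 2) + 2 * (L * 2) ≡ 4 * (L * L + L)
  double = solve-∀
  quadruple : ∀ N → 2 * (N * 2) + 4 ≡ 4 * (1 + N)
  quadruple = solve-∀
  L²+L≤N : L * L + L ≤ N
  -- With `ℓ = 2L` and `n = 2N`, the hypothesis reads `4 (L² + L) < 4 (1 + N)`.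
  L²+L≤N = ≤-pred (*-cancelˡ-< 4 _ _ (subst₂ _<_ (double L) (quadruple N) bound))
  expand : ∀ s t e → let L = suc (t + e) in
           (L * L + L + (t + s * L)) * 2 ≡ L * 2 + L * 2 + ((s + e) * (L * 2) + t * (2 + L * 2))
  expand = solve-∀
  rearrange : ∀ s t e r L₁ → t + e ≡ L₁ → r ≡ t + s * suc L₁ → let L = suc L₁ in
              (L * L + L + r) * 2 ≡ L * 2 + L * 2 + ((s + e) * (L * 2) + t * (2 + L * 2))
  rearrange s t e _ _ refl refl = expand s t e
  split : (∃[ r ] L * L + L + r ≡ N) → ∃₂ λ A B → N * 2 ≡ L * 2 + L * 2 + (A * (L * 2) + B * (2 + L * 2))
  -- Write `r = t + s L` with `t < L` and `e = L − 1 − t`. Then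
  -- `L² − L + r = (s + e) L + t (L + 1)`.
  split (r , refl) with e , eq ← m≤n⇒∃[o]m+o≡n (≤-pred (m%n<n r L)) =
    r / L + e , r % L , rearrange (r / L) (r % L) e r L₁ eq (m≡m%n+[m/n]*n r L)

theorem5p3 : (ℓ m n : ℕ) → 4 ≤ ℓ → Even ℓ → 2 ≤ m → Even m → Even n →
    ℓ * ℓ + 2 * ℓ < 2 * n + 4 →
    HTG-2SpanningCyclable m n ℓ
theorem5p3 _ _ n (s≤s (s≤s 2≤k)) evenℓ@(divides (suc L) refl) 2≤m (divides (suc M) refl) (divides N n≡2N) bound
  with A , B , n≡ ← twoLengths (suc L) N (*-cancelʳ-≤ 2 (suc L) 2 (s≤s (s≤s 2≤k)))
                      (subst (λ n → suc L * 2 * (suc L * 2) + 2 * (suc L * 2) < 2 * n + 4) n≡2N bound)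
  -- The sum forces `n` to be positive; exposing the successor supplies the `NonZero` instance.
  with n | trans n≡2N n≡
... | n@(suc _) | eq = Separation.separated M (L * 2) A B n 2≤k evenℓ eq
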